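{- A map of types $f : A \to B$ is acyclic if and only if it is balanced.
   Context: We work in homotopy type theory (HoTT) in the style of the HoTT Book: dependent type theory with univalent universes (hence function extensionality) and higher inductive types such as pushouts and truncations; no classical axioms are assumed. The suspension $\Sigma A$ of a type $A$ is the pushout of $\mathbf{1} \leftarrow A \to \mathbf{1}$. A type is acyclic if its suspension is contractible; a map is acyclic if all its fibers are acyclic types. A map $f : A \to B$ is balanced if for every surjection $g : X \to B$ (a map all of whose fibers are inhabited, i.e. have inhabited propositional truncation), the pullback square with corners $F = X \times_B A$, $A$, $X$, $B$ (formed from $f$ and $g$) is also a pushout square. -}

{-# OPTIONS --without-K #-}

-- Univalence, pushouts and propositional truncations cannot be postulated under
-- --safe, so they enter as an explicit hypothesis, the record HoTT below.  K would
-- make univalence contradictory, hence --without-K; function extensionality is a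
-- consequence of univalence.

module Defs where

open import Level using (Level; _⊔_; Setω) renaming (suc to lsuc)
open import Data.Product.Base using (Σ-syntax; _,_; proj₁; proj₂)
open import Data.Unit.Base using (⊤; tt)
open import Function.Base using (id)
open import Relation.Binary.PropositionalEquality using (_≡_; refl; trans; cong; subst; dcong)
open import Relation.Nullary.Irrelevant using (Irrelevant)

private
  variable
    a b c p : Level

IsContr : Set a → Set a
IsContr A = Σ[ x ∈ A ] (∀ y → x ≡ y)

fiber : {A : Set a} {B : Set b} → (A → B) → B → Set (a ⊔ b)
fiber {A = A} f y = Σ[ x ∈ A ] f x ≡ y

IsEquiv : {A : Set a} {B : Set b} → (A → B) → Set (a ⊔ b)
IsEquiv f = ∀ y → IsContr (fiber f y)

_≃_ : Set a → Set b → Set (a ⊔ b)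
A ≃ B = Σ[ f ∈ (A → B) ] IsEquiv f

id-isEquiv : (A : Set a) → IsEquiv (id {A = A})
id-isEquiv A y = (y , refl) , λ { (_ , refl) → refl }

idToEquiv : {A B : Set a} → A ≡ B → A ≃ B
idToEquiv {A = A} refl = id , id-isEquiv A

Univalence : Setω
Univalence = ∀ {ℓ} {A B : Set ℓ} → IsEquiv (idToEquiv {A = A} {B = B})

-- Irrelevant is "being a proposition": any two elements are equal.
record PropositionalTruncations : Setω where
  field
    ∥_∥      : Set a → Set a
    ∣_∣      : {A : Set a} → A → ∥ A ∥
    ∥∥-prop  : {A : Set a} → Irrelevant ∥ A ∥
    ∥∥-rec   : {A : Set a} {P : Set p} → Irrelevant P → (A → P) → ∥ A ∥ → P

-- The rules of the higher inductive type.  The computation rules for inl and inr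
-- are identifications, as judgmental equalities cannot be assumed; the rule for
-- glue has to be transported along them.
record PushoutType {A : Set a} {B : Set b} {C : Set c} (f : C → A) (g : C → B) : Setω where
  field
    Carrier : Set (a ⊔ b ⊔ c)
    inl     : A → Carrier
    inr     : B → Carrier
    glue    : ∀ z → inl (f z) ≡ inr (g z)

    ind : (P : Carrier → Set p)
          (l : ∀ x → P (inl x)) (r : ∀ y → P (inr y)) →
          (∀ z → subst P (glue z) (l (f z)) ≡ r (g z)) →
          ∀ w → P w

    ind-inl : (P : Carrier → Set p)
              (l : ∀ x → P (inl x)) (r : ∀ y → P (inr y))
              (e : ∀ z → subst P (glue z) (l (f z)) ≡ r (g z)) →
              ∀ x → ind P l r e (inl x) ≡ l x

    ind-inr : (P : Carrier → Set p)
              (l : ∀ x → P (inl x)) (r : ∀ y → P (inr y))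
              (e : ∀ z → subst P (glue z) (l (f z)) ≡ r (g z)) →
              ∀ y → ind P l r e (inr y) ≡ r y

    ind-glue : (P : Carrier → Set p)
               (l : ∀ x → P (inl x)) (r : ∀ y → P (inr y))
               (e : ∀ z → subst P (glue z) (l (f z)) ≡ r (g z)) →
               ∀ z → trans (dcong (ind P l r e) (glue z)) (ind-inr P l r e (g z))
                   ≡ trans (cong (subst P (glue z)) (ind-inl P l r e (f z))) (e z)

record HoTT : Setω where
  field
    univalence  : Univalence
    truncations : PropositionalTruncations
    pushout     : {A : Set a} {B : Set b} {C : Set c} (f : C → A) (g : C → B) →
                  PushoutType f g

  open PropositionalTruncations truncations public
  module Pushout {a b c} {A : Set a} {B : Set b} {C : Set c} (f : C → A) (g : C → B) =
    PushoutType (pushout f g)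

subst-const : {A : Set a} {D : Set p} {x y : A} (q : x ≡ y) (d : D) →
              subst (λ _ → D) q d ≡ d
subst-const refl d = refl

module _ (𝓗 : HoTT) where
  open HoTT 𝓗

  cogap : {A : Set a} {B : Set b} {C : Set c} {D : Set p} (f : C → A) (g : C → B)
          (i : A → D) (j : B → D) → (∀ z → i (f z) ≡ j (g z)) → Pushout.Carrier f g → D
  cogap {D = D} f g i j H =
    ind (λ _ → D) i j (λ z → trans (subst-const (glue z) (i (f z))) (H z))
    where open Pushout f g

  IsPushoutSquare : {A : Set a} {B : Set b} {C : Set c} {D : Set p}
                    (f : C → A) (g : C → B) (i : A → D) (j : B → D) →
                    (∀ z → i (f z) ≡ j (g z)) → Set (a ⊔ b ⊔ c ⊔ p)
  IsPushoutSquare f g i j H = IsEquiv (cogap f g i j H)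

  Suspension : Set a → Set a
  Suspension A = Pushout.Carrier {A = ⊤} {B = ⊤} {C = A} (λ _ → tt) (λ _ → tt)

  IsAcyclic : Set a → Set a
  IsAcyclic A = IsContr (Suspension A)

  IsAcyclicMap : {A : Set a} {B : Set b} → (A → B) → Set (a ⊔ b)
  IsAcyclicMap f = ∀ y → IsAcyclic (fiber f y)

  IsSurjection : {A : Set a} {B : Set b} → (A → B) → Set (a ⊔ b)
  IsSurjection f = ∀ y → ∥ fiber f y ∥

  Pullback : {A : Set a} {B : Set b} {X : Set c} → (X → B) → (A → B) → Set (a ⊔ b ⊔ c)
  Pullback {A = A} {X = X} g f = Σ[ x ∈ X ] Σ[ y ∈ A ] g x ≡ f y

  -- The universe of X is that of A and B.
  IsBalanced : {A B : Set a} → (A → B) → Set (lsuc a)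
  IsBalanced {a = a} {A = A} {B = B} f =
    {X : Set a} (g : X → B) → IsSurjection g →
    IsPushoutSquare {C = Pullback g f} proj₁ (λ z → proj₁ (proj₂ z)) g f
      (λ z → proj₂ (proj₂ z))

{-# OPTIONS --safe #-}
{-# OPTIONS --without-K #-}

-- Over a point b, the gap map of the pullback square of f and g has as fiber the join
-- of the fibers of g and f over b.  If F is acyclic, then F → 1 is an epimorphism, so
-- a family F → d ≡ d′ is constant.  In the join of F with a type Y containing y₀, the
-- composites inl y₀ ≡ inr x ≡ inl y (x : F) therefore do not depend on x, which
-- contracts the join to inl y₀.  Conversely, the join with the two-element type is the
-- suspension, so balancedness along the projection B × Bool → B makes the suspensions
-- of the fibers of f contractible.

module Submission where

open import Defs
open import Data.Bool.Base using (Bool; true; false)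
open import Data.Product.Base using (Σ-syntax; _×_; _,_; proj₁; proj₂; uncurry)
open import Data.Unit.Base using (⊤; tt)
open import Function.Base using (id; _∘_)
open import Function.Bundles using (_⇔_; mk⇔)
open import Level using (Level)
open import Relation.Binary.PropositionalEquality
  using (_≡_; refl; sym; trans; cong; cong-app; subst; dcong; trans-assoc; trans-reflʳ; trans-symˡ;
         module ≡-Reasoning)
open import Relation.Nullary.Irrelevant using (Irrelevant)

private
  variable
    a b c d ℓ : Level

-- Contractible types and path lifting

IsContr⇒Irrelevant : {A : Set a} → IsContr A → Irrelevant A
IsContr⇒Irrelevant (_ , k) x y = trans (sym (k x)) (k y)

IsContr⇒≡-Irrelevant : {A : Set a} → IsContr A → {x y : A} → Irrelevant (x ≡ y)
IsContr⇒≡-Irrelevant {A = A} (z , k) p q = trans (canonical p) (sym (canonical q))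
  where
  canonical : {x y : A} (p : x ≡ y) → p ≡ trans (sym (k x)) (k y)
  canonical {x} refl = sym (trans-symˡ (k x))

-- Reduces the dependent rule `ind-glue` for a constant family to its non-dependent form.
cong-subst-const : {A : Set a} {D : Set d} (u : A → D) {x y : A} (p : x ≡ y)
                   {l r : D} (α : u x ≡ l) (β : u y ≡ r) (H : l ≡ r) →
                   trans (dcong u p) β
                     ≡ trans (cong (subst (λ _ → D) p) α) (trans (subst-const p l) H) →
                   trans (cong u p) β ≡ trans α H
cong-subst-const u refl refl β H e = e

fiber-lift : {A : Set a} {B : Set b} (k : A → B) {z : B} {w w′ : A} (e : w ≡ w′)
             (q : k w′ ≡ z) →
             _≡_ {A = fiber k z} (w , trans (cong k e) q) (w′ , q)
fiber-lift k refl q = refl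

subst-≡ʳ : {A : Set a} {x y z : A} (p : x ≡ y) (q : y ≡ z) → subst (x ≡_) q p ≡ trans p q
subst-≡ʳ p refl = sym (trans-reflʳ p)

-- Function extensionality from univalence; transport over fibers

module _ (ua : Univalence) where

  -- Univalence reduces this to `idToEquiv refl`, where postcomposition is judgmentally the
  -- identity. Function extensionality can thus be derived from it without circularity.
  postcompose-isEquiv : (C : Set c) {A B : Set ℓ} (e : A ≃ B) →
                        IsEquiv (λ (h : C → A) → proj₁ e ∘ h)
  postcompose-isEquiv C {A} {B} e = subst Q (proj₂ (proj₁ (ua e))) (atPath (proj₁ (proj₁ (ua e))))
    where
    Q : ∀ {B} → A ≃ B → Set _
    Q e = IsEquiv (λ (h : C → A) → proj₁ e ∘ h)

    atPath : ∀ {B} (p : A ≡ B) → Q (idToEquiv p)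
    atPath refl = id-isEquiv (C → A)

  -- Dependent functions are a retract of the fiber over `id` of postcomposition with `proj₁`, which
  -- is an equivalence.
  Π-isContr : {A : Set ℓ} {P : A → Set ℓ} → (∀ x → IsContr (P x)) → IsContr (∀ x → P x)
  Π-isContr {A = A} {P} contr = retract (proj₁ K) , λ k → cong retract (proj₂ K (section k))
    where
    proj₁-isEquiv : IsEquiv (proj₁ {A = A} {B = P})
    proj₁-isEquiv x = ((x , proj₁ (contr x)) , refl) ,
      λ { ((x , y) , refl) → cong (λ y → (x , y) , refl) (proj₂ (contr x) y) }

    Sections : Set _
    Sections = fiber (λ (h : A → Σ[ x ∈ A ] P x) → proj₁ ∘ h) id

    K : IsContr Sections
    K = postcompose-isEquiv A (proj₁ , proj₁-isEquiv) id

    section : (∀ x → P x) → Sections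
    section k = (λ x → x , k x) , refl

    retract : Sections → ∀ x → P x
    retract (h , r) x = subst P (cong-app r x) (proj₂ (h x))

  module _ {A : Set ℓ} {P : A → Set ℓ} {f : ∀ x → P x} where

    private
      Homotopic : Set _
      Homotopic = ∀ x → Σ[ y ∈ P x ] f x ≡ y

      homotopic-isContr : IsContr Homotopic
      homotopic-isContr = Π-isContr λ x → (f x , refl) , λ { (_ , refl) → refl }

      reflPath : {g : ∀ x → P x} (H : ∀ x → f x ≡ g x) →
                 _≡_ {A = Homotopic} (λ x → f x , refl) (λ x → g x , H x)
      reflPath H = IsContr⇒Irrelevant homotopic-isContr _ _

    funext : {g : ∀ x → P x} → (∀ x → f x ≡ g x) → f ≡ g
    funext H = cong (λ k x → proj₁ (k x)) (reflPath H)

    cong-app-funext : {g : ∀ x → P x} (H : ∀ x → f x ≡ g x) (x : A) →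
                      cong-app (funext H) x ≡ H x
    cong-app-funext H x =
      -- Induction along `reflPath H` leaves the reflexive homotopy, for which `reflPath` has the
      -- form `trans (sym k) k` and so is trivial.
      subst (λ k → cong-app (funext (proj₂ ∘ k)) x ≡ proj₂ (k x)) (reflPath H)
        (cong (λ p → cong-app (cong (λ k x → proj₁ (k x)) p) x)
          (trans-symˡ (proj₂ homotopic-isContr (λ x → f x , refl))))

  IsContr-irrelevant : {A : Set ℓ} → Irrelevant (IsContr A)
  IsContr-irrelevant {A = A} C@(x , h) (y , k) = go (h y) k
    where
    go : ∀ {y} → x ≡ y → (k : ∀ z → y ≡ z) → (x , h) ≡ (y , k)
    go refl k = cong (x ,_) (funext λ z → IsContr⇒≡-Irrelevant C (h z) (k z))

  IsEquiv-resp-∼ : {A B : Set ℓ} {f g : A → B} → (∀ x → f x ≡ g x) → IsEquiv f → IsEquiv g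
  IsEquiv-resp-∼ H = subst IsEquiv (funext H)

  trans-isEquiv : {A : Set ℓ} {w x y z : A} (u : w ≡ x) (v : y ≡ z) →
                  IsEquiv (λ (s : x ≡ y) → trans u (trans s v))
  trans-isEquiv refl refl = IsEquiv-resp-∼ (λ s → sym (trans-reflʳ s)) (id-isEquiv _)

  -- Supplies the glue case when a contraction of `fiber k z` onto `o` is built by induction on the
  -- first component.
  subst-fiber-≡ : {A B : Set ℓ} (k : A → B) {z : B} (o : fiber k z) {w w′ : A} (e : w ≡ w′)
                  (l : ∀ q → o ≡ (w , q)) (r : ∀ q → o ≡ (w′ , q)) →
                  (∀ q → trans (l (trans (cong k e) q)) (fiber-lift k e q) ≡ r q) →
                  subst (λ w → ∀ q → o ≡ (w , q)) e l ≡ r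
  subst-fiber-≡ k o refl l r E = funext λ q → trans (sym (trans-reflʳ (l q))) (E q)

  module _ {A B D : Set ℓ} (k : A → B) {z : B} where

    subst-fiber-→ : {w w′ : A} (e : w ≡ w′) {l : k w ≡ z → D} {r : k w′ ≡ z → D} →
                    (∀ q → l (trans (cong k e) q) ≡ r q) →
                    subst (λ w → k w ≡ z → D) e l ≡ r
    subst-fiber-→ refl = funext

    -- Converts `ind-glue` for a curried map out of `fiber k z` into the action of the uncurried map
    -- on a lifted path.
    cong-fiber-→ : (U : ∀ w → k w ≡ z → D) {w w′ : A} (e : w ≡ w′)
                   {l : k w ≡ z → D} {r : k w′ ≡ z → D} (α : U w ≡ l) (β : U w′ ≡ r)
                   (E : ∀ q → l (trans (cong k e) q) ≡ r q) →
                   trans (dcong U e) β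
                     ≡ trans (cong (subst (λ w → k w ≡ z → D) e) α) (subst-fiber-→ e E) →
                   ∀ q → trans (cong (uncurry U) (fiber-lift k e q)) (cong-app β q)
                       ≡ trans (cong-app α (trans (cong k e) q)) (E q)
    cong-fiber-→ U refl refl β E c q =
      trans (cong (λ p → cong-app p q) c) (cong-app-funext E q)

-- Cancellation of paths

trans-trans-sym : {A : Set a} {x y z : A} (p : x ≡ y) (q : z ≡ y) → trans (trans p (sym q)) q ≡ p
trans-trans-sym refl refl = refl

trans-sym-trans : {A : Set a} {x y z : A} (p : x ≡ y) (q : x ≡ z) → trans p (trans (sym p) q) ≡ q
trans-sym-trans refl q = refl

-- The two legs of the cospan meet at `z`, so their common correction `β` cancels and only `m`
-- remains.
cong-cospan : {A : Set a} {D : Set d} (u : A → D) {x x′ z : A} (p : x ≡ z) (p′ : x′ ≡ z)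
              {n s : D} (α : u x ≡ n) (α′ : u x′ ≡ s) (β : u z ≡ s) (m : n ≡ s) →
              trans (cong u p) β ≡ trans α m → trans (cong u p′) β ≡ trans α′ refl →
              trans (sym α) (trans (cong u (trans p (sym p′))) α′) ≡ m
cong-cospan u refl refl refl α′ β m h h′ = trans (trans (sym (trans-reflʳ α′)) (sym h′)) h

module _ (𝓗 : HoTT) where
  open HoTT 𝓗

  -- Computation rules of the cogap map

  module Cogap {A : Set a} {B : Set b} {C : Set c} {D : Set d} (f : C → A) (g : C → B)
               (i : A → D) (j : B → D) (H : ∀ z → i (f z) ≡ j (g z)) where
    open Pushout f g

    gap : Carrier → D
    gap = cogap 𝓗 f g i j H

    private
      E : ∀ z → subst (λ _ → D) (glue z) (i (f z)) ≡ j (g z)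
      E z = trans (subst-const (glue z) (i (f z))) (H z)

    gap-inl : ∀ x → gap (inl x) ≡ i x
    gap-inl = ind-inl (λ _ → D) i j E

    gap-inr : ∀ y → gap (inr y) ≡ j y
    gap-inr = ind-inr (λ _ → D) i j E

    gap-glue : ∀ z → trans (cong gap (glue z)) (gap-inr (g z)) ≡ trans (gap-inl (f z)) (H z)
    gap-glue z = cong-subst-const gap (glue z) (gap-inl (f z)) (gap-inr (g z)) (H z)
      (ind-glue (λ _ → D) i j E z)

    -- Isolates `H z` between two fixed paths.
    gap-glue-trans : ∀ z {y} (q : gap (inr (g z)) ≡ y) →
                     trans (cong gap (glue z)) q
                       ≡ trans (gap-inl (f z)) (trans (H z) (trans (sym (gap-inr (g z))) q))
    gap-glue-trans z q = begin
      trans (cong gap (glue z)) q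
        ≡⟨ cong (trans (cong gap (glue z))) (trans-sym-trans β q) ⟨
      trans (cong gap (glue z)) (trans β (trans (sym β) q))
        ≡⟨ trans-assoc (cong gap (glue z)) ⟨
      trans (trans (cong gap (glue z)) β) (trans (sym β) q)
        ≡⟨ cong (λ p → trans p (trans (sym β) q)) (gap-glue z) ⟩
      trans (trans (gap-inl (f z)) (H z)) (trans (sym β) q)
        ≡⟨ trans-assoc (gap-inl (f z)) ⟩
      trans (gap-inl (f z)) (trans (H z) (trans (sym β) q)) ∎
      where
      open ≡-Reasoning
      β = gap-inr (g z)

  -- Suspensions and acyclic types

  module Susp (F : Set a) where
    open Pushout {A = ⊤} {B = ⊤} {C = F} (λ _ → tt) (λ _ → tt) public

    north south : Suspension 𝓗 F
    north = inl tt
    south = inr tt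

  -- `φ` induces a map from the suspension to `D` that takes the meridian of `z` to `φ z`, up to the
  -- computation rules at the poles. In a contractible suspension all meridians coincide.
  acyclic⇒constant : {F : Set a} → IsAcyclic 𝓗 F → {D : Set d} {x y : D} (φ : F → x ≡ y) →
                     Σ[ p ∈ x ≡ y ] (∀ z → p ≡ φ z)
  acyclic⇒constant {F = F} acyclic {x = x} {y} φ =
    trans (sym (gap-inl tt)) (trans (cong gap meridian) (gap-inr tt)) , constant
    where
    open Susp F
    open Cogap {C = F} (λ _ → tt) (λ _ → tt) (λ _ → x) (λ _ → y) φ

    meridian : north ≡ south
    meridian = IsContr⇒Irrelevant acyclic north south

    constant : ∀ z → _ ≡ φ z
    constant z = begin
      trans (sym (gap-inl tt)) (trans (cong gap meridian) (gap-inr tt))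
        ≡⟨ cong (λ m → trans (sym (gap-inl tt)) (trans (cong gap m) (gap-inr tt)))
             (IsContr⇒≡-Irrelevant acyclic meridian (glue z)) ⟩
      trans (sym (gap-inl tt)) (trans (cong gap (glue z)) (gap-inr tt))
        ≡⟨ cong (trans (sym (gap-inl tt))) (gap-glue z) ⟩
      trans (sym (gap-inl tt)) (trans (gap-inl tt) (φ z))
        ≡⟨ trans-assoc (sym (gap-inl tt)) ⟨
      trans (trans (sym (gap-inl tt)) (gap-inl tt)) (φ z)
        ≡⟨ cong (λ p → trans p (φ z)) (trans-symˡ (gap-inl tt)) ⟩
      φ z ∎
      where open ≡-Reasoning

  constant-glue⇒acyclic : {F : Set a} (p : Susp.north F ≡ Susp.south F) →
                          (∀ z → p ≡ Susp.glue F z) → IsAcyclic 𝓗 F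
  constant-glue⇒acyclic {F = F} p constant =
    north , ind (north ≡_) (λ _ → refl) (λ _ → p)
              (λ z → trans (subst-≡ʳ refl (glue z)) (sym (constant z)))
    where open Susp F

  -- Fibers of the gap map, and acyclic maps are balanced

  module _ {A B X : Set ℓ} (f : A → B) (g : X → B) where

    module Gap where
      open Pushout {C = Pullback 𝓗 g f} proj₁ (λ z → proj₁ (proj₂ z)) public
      open Cogap {C = Pullback 𝓗 g f} proj₁ (λ z → proj₁ (proj₂ z)) g f (λ z → proj₂ (proj₂ z)) public

    open Gap

    glue-trans : ∀ x a {y} (q : gap (inr a) ≡ y) → g x ≡ f a → gap (inl x) ≡ y
    glue-trans x a q s = trans (cong gap (glue (x , a , s))) q

    -- By `gap-glue-trans` this is composition with fixed paths on both sides. Hence any `q` over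
    -- `inl x` comes from an essentially unique `s : g x ≡ f a`.
    glue-trans-isEquiv : ∀ x a {y} (q : gap (inr a) ≡ y) → IsEquiv (glue-trans x a q)
    glue-trans-isEquiv x a q =
      IsEquiv-resp-∼ univalence (λ s → sym (gap-glue-trans (x , a , s) q))
        (trans-isEquiv univalence (gap-inl x) (trans (sym (gap-inr a)) q))

    module _ {y : B} (acyclic : IsAcyclic 𝓗 (fiber f y)) (t₀ : fiber g y) where

      -- bridge plays the role of the glue of the join fiber g y * fiber f y.
      private
        centre : fiber gap y
        centre = inl (proj₁ t₀) , trans (gap-inl (proj₁ t₀)) (proj₂ t₀)

        glued : ∀ {x a} {q : gap (inl x) ≡ y} {q′ : gap (inr a) ≡ y} →
                fiber (glue-trans x a q′) q → _≡_ {A = fiber gap y} (inl x , q) (inr a , q′)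
        glued {x} {a} {q′ = q′} (s , refl) = fiber-lift gap (glue (x , a , s)) q′

        bridge : ∀ {x a} (q : gap (inl x) ≡ y) (q′ : gap (inr a) ≡ y) →
                 _≡_ {A = fiber gap y} (inl x , q) (inr a , q′)
        bridge {x} {a} q q′ = glued (proj₁ (glue-trans-isEquiv x a q′ q))

        bridge-glue : ∀ x a s (q : gap (inr a) ≡ y) →
                      bridge (glue-trans x a q s) q ≡ fiber-lift gap (glue (x , a , s)) q
        bridge-glue x a s q = cong glued (proj₂ (glue-trans-isEquiv x a q _) (s , refl))

        detour : ∀ {x a} (q : gap (inl x) ≡ y) (q′ : gap (inr a) ≡ y) → centre ≡ (inl x , q)
        detour q q′ = trans (bridge _ q′) (sym (bridge q q′))

        detour-constant : ∀ x (q : gap (inl x) ≡ y) →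
                          Σ[ p ∈ centre ≡ (inl x , q) ]
                            (∀ ((a , t) : fiber f y) → p ≡ detour q (trans (gap-inr a) t))
        detour-constant x q =
          acyclic⇒constant acyclic (λ (a , t) → detour q (trans (gap-inr a) t))

        toInl : ∀ x (q : gap (inl x) ≡ y) → centre ≡ (inl x , q)
        toInl x q = proj₁ (detour-constant x q)

        toInl-detour : ∀ x q a (q′ : gap (inr a) ≡ y) → toInl x q ≡ detour q q′
        toInl-detour x q a q′ =
          -- Constancy is known for paths of the form `trans (gap-inr a) t`; every `q′` has this
          -- form.
          subst (λ q′ → toInl x q ≡ detour q q′) (trans-sym-trans (gap-inr a) q′)
            (proj₂ (detour-constant x q) (a , trans (sym (gap-inr a)) q′))

        -- Since `toInl` equals every detour, the one through the same `a` may be used; its return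
        -- leg cancels against the glue.
        toInl-glue : ∀ x a s (q : gap (inr a) ≡ y) →
                     trans (toInl x (glue-trans x a q s)) (fiber-lift gap (glue (x , a , s)) q)
                       ≡ bridge _ q
        toInl-glue x a s q = begin
          trans (toInl x (glue-trans x a q s)) (fiber-lift gap (glue (x , a , s)) q)
            ≡⟨ cong (λ p → trans p (fiber-lift gap (glue (x , a , s)) q)) (toInl-detour x _ a q) ⟩
          trans (detour (glue-trans x a q s) q) (fiber-lift gap (glue (x , a , s)) q)
            ≡⟨ cong (trans (detour (glue-trans x a q s) q)) (bridge-glue x a s q) ⟨
          trans (detour (glue-trans x a q s) q) (bridge (glue-trans x a q s) q)
            ≡⟨ trans-trans-sym (bridge _ q) (bridge (glue-trans x a q s) q) ⟩
          bridge _ q ∎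
          where open ≡-Reasoning

      gap-fiber-isContr : IsContr (fiber gap y)
      gap-fiber-isContr = centre , uncurry
        (ind (λ w → ∀ q → centre ≡ (w , q)) toInl (λ a q → bridge _ q)
          (λ (x , a , s) → subst-fiber-≡ univalence gap centre (glue (x , a , s))
            (toInl x) (bridge _) (toInl-glue x a s)))

  acyclic⇒balanced : {A B : Set ℓ} (f : A → B) → IsAcyclicMap 𝓗 f → IsBalanced 𝓗 f
  acyclic⇒balanced f acyclic g surjective y =
    -- Contractibility is a proposition, so a merely existing point of `fiber g y` suffices.
    ∥∥-rec (IsContr-irrelevant univalence) (gap-fiber-isContr f g (acyclic y)) (surjective y)

  -- Joins with `Bool`, and balanced maps are acyclic

  module _ {A B : Set ℓ} (f : A → B) (y : B) where
    open Gap f (proj₁ {A = B} {B = λ _ → Bool})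
    open Susp (fiber f y) using (north; south) renaming (glue to meridian)

    private
      -- `toSusp` is the comparison from the join of `Bool` and `fiber f y` to the suspension. The
      -- right-hand side and `false` are collapsed to `south`, so only the glue at `true` gives
      -- meridians.
      pole : B × Bool → Suspension 𝓗 (fiber f y)
      pole (_ , true)  = north
      pole (_ , false) = south

      pole-meridian : ∀ x → fiber f y → pole x ≡ south
      pole-meridian (_ , true)  t = meridian t
      pole-meridian (_ , false) t = refl

      Fam : Carrier → Set _
      Fam w = gap w ≡ y → Suspension 𝓗 (fiber f y)

      l : ∀ x → Fam (inl x)
      l x _ = pole x

      r : ∀ a → Fam (inr a)
      r a _ = south

      E : ∀ ((x , a , s) : Pullback 𝓗 proj₁ f) (q : gap (inr a) ≡ y) → pole x ≡ south
      E (x , a , s) q = pole-meridian x (a , trans (sym (gap-inr a)) q)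

      e : ∀ ((x , a , s) : Pullback 𝓗 proj₁ f) →
          subst Fam (glue (x , a , s)) (l x) ≡ r a
      e z = subst-fiber-→ univalence gap (glue z) (E z)

      toSusp : ∀ w → Fam w
      toSusp = ind Fam l r e

      toSusp-inl : ∀ x q → toSusp (inl x) q ≡ pole x
      toSusp-inl x = cong-app (ind-inl Fam l r e x)

      toSusp-inr : ∀ a q → toSusp (inr a) q ≡ south
      toSusp-inr a = cong-app (ind-inr Fam l r e a)

      toSusp-glue : ∀ ((x , a , s) : Pullback 𝓗 proj₁ f) (q : gap (inr a) ≡ y) →
                    trans (cong (uncurry toSusp) (fiber-lift gap (glue (x , a , s)) q)) (toSusp-inr a q)
                      ≡ trans (toSusp-inl x _) (E (x , a , s) q)
      toSusp-glue z = cong-fiber-→ univalence gap toSusp (glue z) _ _ (E z) (ind-glue Fam l r e z)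

      point : ∀ i → fiber gap y
      point i = inl (y , i) , gap-inl (y , i)

      -- Records the glue of the join from `i` to `(a , t)` with its image under `toSusp`: a
      -- meridian for `true`, `refl` for `false`.
      spoke : ∀ i ((a , t) : fiber f y) →
              Σ[ p ∈ point i ≡ (inr a , trans (gap-inr a) t) ]
                trans (cong (uncurry toSusp) p) (toSusp-inr a _)
                  ≡ trans (toSusp-inl (y , i) _) (pole-meridian (y , i) (a , t))
      spoke i (a , t) = over
        (trans (gap-glue-trans ((y , i) , a , sym t) q)
          (trans (cong (λ t′ → trans (gap-inl (y , i)) (trans (sym t) t′)) t≡)
            (trans (cong (trans (gap-inl (y , i))) (trans-symˡ t)) (trans-reflʳ _))))
        t≡
        where
        q : gap (inr a) ≡ y
        q = trans (gap-inr a) t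

        t≡ : trans (sym (gap-inr a)) q ≡ t
        t≡ = trans (sym (trans-assoc (sym (gap-inr a)))) (cong (λ p → trans p t) (trans-symˡ (gap-inr a)))

        -- Making `q₀` and `t′` variables allows both identities to be matched with `refl`.
        over : ∀ {q₀ t′} → trans (cong gap (glue ((y , i) , a , sym t))) q ≡ q₀ →
               trans (sym (gap-inr a)) q ≡ t′ →
               Σ[ p ∈ (inl (y , i) , q₀) ≡ (inr a , q) ]
                 trans (cong (uncurry toSusp) p) (toSusp-inr a q)
                   ≡ trans (toSusp-inl (y , i) q₀) (pole-meridian (y , i) (a , t′))
        over refl refl =
          fiber-lift gap (glue ((y , i) , a , sym t)) q , toSusp-glue ((y , i) , a , sym t) q

    -- Contractibility identifies `π` with the path out along `spoke true t` and back along
    -- `spoke false t`, whose image is `meridian t`. So the image of `π` equals every meridian.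
    gap-fiber-isContr⇒acyclic : IsContr (fiber gap y) → IsAcyclic 𝓗 (fiber f y)
    gap-fiber-isContr⇒acyclic contr = constant-glue⇒acyclic
      (trans (sym (toSusp-inl (y , true) _)) (trans (cong (uncurry toSusp) π) (toSusp-inl (y , false) _)))
      constant
      where
      π : point true ≡ point false
      π = IsContr⇒Irrelevant contr _ _

      constant : ∀ t → _ ≡ meridian t
      constant t = trans
        (cong (λ p → trans (sym (toSusp-inl (y , true) _))
                       (trans (cong (uncurry toSusp) p) (toSusp-inl (y , false) _)))
          (IsContr⇒≡-Irrelevant contr π
            (trans (proj₁ (spoke true t)) (sym (proj₁ (spoke false t))))))
        (cong-cospan (uncurry toSusp) (proj₁ (spoke true t)) (proj₁ (spoke false t))
          (toSusp-inl (y , true) _) (toSusp-inl (y , false) _) (toSusp-inr (proj₁ t) _)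
          (meridian t) (proj₂ (spoke true t)) (proj₂ (spoke false t)))

  balanced⇒acyclic : {A B : Set ℓ} (f : A → B) → IsBalanced 𝓗 f → IsAcyclicMap 𝓗 f
  balanced⇒acyclic f balanced y = gap-fiber-isContr⇒acyclic f y
    -- The projection from `B × Bool` is surjective because `b ↦ (b , true)` is a section.
    (balanced proj₁ (λ b → ∣ (b , true) , refl ∣) y)

theorem2p26 : (𝓗 : HoTT) → ∀ {ℓ} {A B : Set ℓ} (f : A → B) → IsAcyclicMap 𝓗 f ⇔ IsBalanced 𝓗 f
theorem2p26 𝓗 f = mk⇔ (acyclic⇒balanced 𝓗 f) (balanced⇒acyclic 𝓗 f)
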